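{- Let $M$ be an $L$-structure and $\phi(x,y)$ an $L$-formula. Let $\epsilon>0$ and suppose $\phi(x,y)$ is $\epsilon$-stable in $M$. Let $p\in S_{\phi(x)}(M)$ and $q\in S_{\phi^*(y)}(M)$. Let $\psi_p(y)$, $\psi_q(x)$ and $\delta_p,\delta_q>0$ be such that 1. $\psi_p(y)$ is a $\phi^*(y)$-formula over $M$ and $\mathfrak d(\phi(p,b),\psi_p^M(b))\leq\delta_p$ for all $b\in M^y$, and 2. $\psi_q(x)$ is a $\phi(x)$-formula over $M$ and $\mathfrak d(\phi^*(q,a),\psi_q^M(a))\leq\delta_q$ for all $a\in M^x$. Then $\mathfrak d(\psi_p(q),\psi_q(p))\leq\delta_p+\delta_q+\epsilon$.
   Context: Logic: We work in continuous (metric) first-order logic with values in $\mathfrak V=\ell^\infty(\omega)$ (real Banach space), with metric $\mathfrak d(\mathfrak r,\mathfrak s)=\|\mathfrak r-\mathfrak s\|_\infty$; an isometric copy $\mathbb R\hookrightarrow\mathfrak V$ is fixed. It is set up as standard $[0,1]$-valued continuous logic (complete metric structures, possibly many-sorted, symbols with prescribed moduli of uniform continuity), except that each predicate symbol $P$ of the language $L$ comes with a compact set $K_P\subseteq\mathfrak V$ in which it takes values; connectives are all continuous functions $u:\mathfrak V^n\to\mathfrak V$; and $\sup_x\psi$, $\inf_x\psi$ are formed only for formulas $\psi$ with value set $K_\psi\subseteq\mathbb R^{\geq0}$. Inductively each formula $\phi$ has a compact value set $K_\phi\subseteq\mathfrak V$ ($K_{u(\phi_0,\ldots,\phi_{n-1})}=u(\prod_i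 K_{\phi_i})$, and $K_{\sup_x\psi}=K_{\inf_x\psi}=K_\psi$), and $\phi^M$ takes values in $K_\phi$ in every $L$-structure $M$. Here $x,y$ are tuples of variables and $M^x$ is the product of sorts of $M$ corresponding to $x$. $N\succeq M$ means $N$ is an elementary extension of $M$. Types: $\phi^*(y,x)$ is the formula $\phi(x,y)$ with the roles of object and parameter variables swapped. $S_{\phi(x)}(M)$ is the set of complete $\phi(x)$-types over $M$. A type $p\in S_{\phi(x)}(M)$ is determined by the function $b\mapsto\phi(p,b)$ from $M^y$ to $K_\phi$, where $\phi(p,b)=\phi^N(a,b)$ for any realization $a\in N^x$ of $p$ in some $N\succeq M$. Likewise, $S_{\phi^*(y)}(M)$ is the set of complete $\phi^*(y)$-types over $M$, a type $q$ being determined by $a\mapsto\phi^*(q,a)=\phi^N(a,b)$, $a\in M^x$, for any realization $b\in N^y$ of $q$. A $\phi^*(y)$-formula over $M$ is a formula of the form $u(\phi(a_0,y),\ldots,\phi(a_{n-1},y))$ with $a_i\in M^x$ and $u:\mathfrak V^n\to\mathfrak V$ continuous; a $\phi(x)$-formula over $M$ is a formula of the form $u(\phi(x,b_0),\ldots,\phi(x,b_{n-1}))$ with $b_i\in M^y$ and $u$ continuous. They are evaluated on types by evaluating at realizations: $\psi_p(q)=u(\phi^*(q,a_0),\ldots,\phi^*(q,a_{n-1}))$ for $\psi_p=u(\phi(a_0,y),\ldots,\phi(a_{n-1},y))$, and similarly for $\psi_q(p)$. Stability: $\phi(x,y)$ is $\epsilon$-stable in $M$ if there are no sequences $\langle a_i\rangle_{i<\omega}$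 in $M^x$ and $\langle b_i\rangle_{i<\omega}$ in $M^y$ such that $\mathfrak d(\phi^M(a_i,b_j),\phi^M(a_j,b_i))\geq\epsilon$ for all $i<j<\omega$. -}

module Defs where

open import Algebra.Core using (Op₁; Op₂)
open import Algebra.Bundles using (CommutativeRing)
open import Algebra.Structures using (IsCommutativeRing)
import Algebra.Construct.NaturalChoice.Max as Max
import Algebra.Properties.Ring as RingProperties
open import Axiom.ExcludedMiddle using (ExcludedMiddle)
open import Data.Fin.Base using (Fin)
open import Data.List.Base using (List; []; _∷_)
open import Data.List.Membership.Propositional using (_∈_)
open import Data.List.Relation.Ternary.Interleaving.Propositional
  using (Interleaving; []; consˡ; consʳ; swap)
open import Data.List.Relation.Unary.All as All using (All; []; _∷_)
open import Data.List.Relation.Unary.Any using (Any)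
open import Data.Nat.Base as ℕ using (ℕ)
open import Data.Product.Base using (Σ; ∃; _×_; _,_; proj₁; proj₂)
open import Data.Vec.Functional using (Vector)
open import Function.Metric.Structures using (IsGeneralMetric)
open import Level using (0ℓ)
open import Relation.Binary.Bundles using (TotalOrder)
open import Relation.Binary.Core using (Rel)
open import Relation.Binary.PropositionalEquality.Core using (_≡_; refl; cong)
open import Relation.Binary.Structures using (IsTotalOrder)
import Relation.Binary.Construct.NonStrictToStrict as ToStrict
open import Relation.Nullary.Decidable.Core using (yes; no)
open import Relation.Nullary.Negation.Core using (¬_)
open import Relation.Unary using (Pred; _⊆_)

-- The field of real numbers, given by its characterisation (unique up to
-- isomorphism) as a Dedekind-complete ordered field.

record CompleteOrderedField : Set₁ where
  infix  8 -_
  infixl 7 _*_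
  infixl 6 _+_ _-_
  infix  4 _≈_ _≤_
  field
    Carrier           : Set
    _≈_               : Rel Carrier 0ℓ
    _≤_               : Rel Carrier 0ℓ
    _+_               : Op₂ Carrier
    _*_               : Op₂ Carrier
    -_                : Op₁ Carrier
    0#                : Carrier
    1#                : Carrier
    isCommutativeRing : IsCommutativeRing _≈_ _+_ _*_ -_ 0# 1#
    0≉1               : ¬ (0# ≈ 1#)
    *-inverse         : ∀ {x} → ¬ (x ≈ 0#) → ∃ λ y → x * y ≈ 1#
    isTotalOrder      : IsTotalOrder _≈_ _≤_
    +-monoˡ-≤         : ∀ z {x y} → x ≤ y → x + z ≤ y + z
    *-nonNegative     : ∀ {x y} → 0# ≤ x → 0# ≤ y → 0# ≤ x * y

  IsUpperBound : Pred Carrier 0ℓ → Pred Carrier 0ℓ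
  IsUpperBound P u = ∀ r → P r → r ≤ u

  IsSupremum : Pred Carrier 0ℓ → Pred Carrier 0ℓ
  IsSupremum P s = IsUpperBound P s × (∀ u → IsUpperBound P u → s ≤ u)

  field
    supremum : (P : Pred Carrier 0ℓ) → ∃ P → ∃ (IsUpperBound P) → ∃ (IsSupremum P)

  commutativeRing : CommutativeRing 0ℓ 0ℓ
  commutativeRing = record { isCommutativeRing = isCommutativeRing }

  totalOrder : TotalOrder 0ℓ 0ℓ 0ℓ
  totalOrder = record { isTotalOrder = isTotalOrder }

  _-_ : Op₂ Carrier
  x - y = x + (- y)

  open ToStrict _≈_ _≤_ public using (_<_)
  open Max totalOrder public using (_⊔_)

  ∣_∣ : Op₁ Carrier
  ∣ x ∣ = x ⊔ (- x)

  ∣x-y∣≤∣x∣+∣y∣ : ∀ x y → ∣ x - y ∣ ≤ ∣ x ∣ + ∣ y ∣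
  ∣x-y∣≤∣x∣+∣y∣ x y = MaxP.⊔-lub
    (+-mono (MaxP.x≤x⊔y x (- x)) (MaxP.x≤y⊔x y (- y)))
    (O.trans (O.reflexive (R.trans (R.sym (RP.-‿+-comm x (- y)))
                                   (R.+-congˡ (RP.-‿involutive y))))
             (+-mono (MaxP.x≤y⊔x x (- x)) (MaxP.x≤x⊔y y (- y))))
    where
    module R = CommutativeRing commutativeRing
    module RP = RingProperties R.ring
    module O = TotalOrder totalOrder
    module MaxP = Max totalOrder
    +-mono : ∀ {a b c d} → a ≤ b → c ≤ d → a + c ≤ b + d
    +-mono {a} {b} {c} {d} a≤b c≤d = O.trans (+-monoˡ-≤ c a≤b)
      (O.trans (O.reflexive (R.+-comm b c))
      (O.trans (+-monoˡ-≤ b c≤d) (O.reflexive (R.+-comm d b))))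

-- The Banach space ℓ^∞(ω) as a metric space.

module Linfty (ℝ : CompleteOrderedField) where
  open CompleteOrderedField ℝ using (_≈_; _≤_; _<_; _+_; 0#; ∣_∣; ∣x-y∣≤∣x∣+∣y∣; supremum)
    renaming (Carrier to R; _-_ to _-ᵣ_)

  infixl 6 _-_
  infix  4 _≈ᵥ_

  record 𝔙 : Set where
    field
      seq     : ℕ → R
      bounded : ∃ λ c → ∀ n → ∣ seq n ∣ ≤ c
  open 𝔙 public

  _≈ᵥ_ : Rel 𝔙 0ℓ
  v ≈ᵥ w = ∀ n → seq v n ≈ seq w n

  ‖_‖ : 𝔙 → R
  ‖ v ‖ = proj₁ (supremum (λ r → ∃ λ n → r ≈ ∣ seq v n ∣)
    (∣ seq v 0 ∣ , 0 , IsTO.Eq.refl)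
    (proj₁ (bounded v) , λ { r (n , r≈) → IsTO.trans (IsTO.reflexive r≈) (proj₂ (bounded v) n) }))
    where module IsTO = IsTotalOrder (CompleteOrderedField.isTotalOrder ℝ)

  _-_ : Op₂ 𝔙
  seq     (v - w) n = seq v n -ᵣ seq w n
  bounded (v - w)   = proj₁ (bounded v) + proj₁ (bounded w) ,
    λ n → O.trans (∣x-y∣≤∣x∣+∣y∣ (seq v n) (seq w n))
         (O.trans (CF.+-monoˡ-≤ ∣ seq w n ∣ (proj₂ (bounded v) n))
         (O.trans (O.reflexive (R.+-comm (proj₁ (bounded v)) ∣ seq w n ∣))
         (O.trans (CF.+-monoˡ-≤ (proj₁ (bounded v)) (proj₂ (bounded w) n))
                  (O.reflexive (R.+-comm (proj₁ (bounded w)) (proj₁ (bounded v)))))))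
    where
    module CF = CompleteOrderedField ℝ
    module R = CommutativeRing CF.commutativeRing
    module O = TotalOrder CF.totalOrder

  𝔡 : 𝔙 → 𝔙 → R
  𝔡 v w = ‖ v - w ‖

  Open : Pred (Pred 𝔙 0ℓ) 0ℓ
  Open U = ∀ v → U v → ∃ λ η → 0# < η × (∀ w → 𝔡 v w < η → U w)

  Compact : Pred 𝔙 0ℓ → Set₁
  Compact K = (I : Set) (U : I → Pred 𝔙 0ℓ) → (∀ i → Open (U i)) →
    (∀ v → K v → ∃ λ i → U i v) →
    ∃ λ (is : List I) → ∀ v → K v → Any (λ i → U i v) is

  Continuous : ∀ {n} → (Vector 𝔙 n → 𝔙) → Set
  Continuous {n} u = ∀ v ε → 0# < ε → ∃ λ η → 0# < η ×
    (∀ w → (∀ i → 𝔡 (v i) (w i) < η) → 𝔡 (u v) (u w) < ε)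

record IsometricCopy (ℝ : CompleteOrderedField) : Set where
  open CompleteOrderedField ℝ using (Carrier; _≈_; _-_; ∣_∣)
  open Linfty ℝ using (𝔙; 𝔡)
  field
    ι        : Carrier → 𝔙
    isometry : ∀ r s → 𝔡 (ι r) (ι s) ≈ ∣ r - s ∣

module ContinuousLogic
  (em : ExcludedMiddle 0ℓ) (ℝ : CompleteOrderedField) (copy : IsometricCopy ℝ) where

  open CompleteOrderedField ℝ
    using (_≈_; -_; 1#; IsUpperBound; supremum)
  open CompleteOrderedField ℝ public
    using (_≤_; _<_; _+_; 0#) renaming (Carrier to R)
  open Linfty ℝ using (𝔙; _≈ᵥ_; Compact; Continuous)
  open Linfty ℝ public using (𝔡)
  open IsometricCopy copy using (ι)

  -- Supremum and infimum totalised by 0#.  They are applied below only to the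
  -- values of a formula, a nonempty subset of a compact set of nonnegative reals
  -- (sorts are inhabited), so that the default value does not occur.

  sup : Pred R 0ℓ → R
  sup P with em {∃ P × ∃ (IsUpperBound P)}
  ... | yes (inhabited , bounded) = proj₁ (supremum P inhabited bounded)
  ... | no _                      = 0#

  inf : Pred R 0ℓ → R
  inf P = - sup (λ r → P (- r))

  ℝ≥0 : Pred 𝔙 0ℓ
  ℝ≥0 v = ∃ λ r → 0# ≤ r × v ≈ᵥ ι r

  [0,1] : Pred 𝔙 0ℓ
  [0,1] v = ∃ λ r → (0# ≤ r × r ≤ 1#) × v ≈ᵥ ι r

  record Modulus : Set where
    field
      Δ        : R → R
      positive : ∀ ε → 0# < ε → 0# < Δ ε

  record Language : Set₁ where
    field
      Sort         : Set
      Func         : List Sort → Sort → Set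
      Predicate    : List Sort → Set
      funcModulus  : ∀ {As s} → Func As s → Modulus
      predModulus  : ∀ {As} → Predicate As → Modulus
      valueSet     : ∀ {As} → Predicate As → Pred 𝔙 0ℓ
      valueSet-≈   : ∀ {As} (P : Predicate As) {v w} → v ≈ᵥ w → valueSet P v → valueSet P w
      valueSet-cpt : ∀ {As} (P : Predicate As) → Compact (valueSet P)

  module _ (L : Language) where
    open Language L

    -- A tuple of variables is the list of their sorts.
    Ctx : Set
    Ctx = List Sort

    -- The equality of a sort is the setoid equality _≋_, which by the metric
    -- axioms is the same as being at distance zero.
    record Structure : Set₁ where
      infix 4 _≋_
      field
        Carrier   : Sort → Set
        _≋_       : ∀ {s} → Rel (Carrier s) 0ℓ
        dist      : ∀ {s} → Carrier s → Carrier s → R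
        isMetric  : ∀ {s} → IsGeneralMetric (_≋_ {s}) _≈_ _≤_ 0# _+_ (dist {s})
        dist≤1    : ∀ {s} (a b : Carrier s) → dist a b ≤ 1#
        inhabited : ∀ s → Carrier s
        complete  : ∀ {s} (a : ℕ → Carrier s) →
          (∀ ε → 0# < ε → ∃ λ N → ∀ m n → N ℕ.≤ m → N ℕ.≤ n → dist (a m) (a n) < ε) →
          ∃ λ l → ∀ ε → 0# < ε → ∃ λ N → ∀ n → N ℕ.≤ n → dist (a n) l < ε

      Env : Ctx → Set
      Env = All Carrier

      Near : ∀ {As} → R → Env As → Env As → Set
      Near η a b = ∀ {s} (i : s ∈ _) → dist (All.lookup a i) (All.lookup b i) < η

      field
        func      : ∀ {As s} → Func As s → Env As → Carrier s
        func-unif : ∀ {As s} (f : Func As s) ε → 0# < ε → ∀ a b →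
          Near (Modulus.Δ (funcModulus f) ε) a b → dist (func f a) (func f b) ≤ ε
        pred      : ∀ {As} → Predicate As → Env As → 𝔙
        pred-unif : ∀ {As} (P : Predicate As) ε → 0# < ε → ∀ a b →
          Near (Modulus.Δ (predModulus P) ε) a b → 𝔡 (pred P a) (pred P b) ≤ ε
        pred∈K    : ∀ {As} (P : Predicate As) a → valueSet P (pred P a)

    data Term (Γ : Ctx) : Sort → Set where
      var : ∀ {s} → s ∈ Γ → Term Γ s
      app : ∀ {As s} → Func As s → All (Term Γ) As → Term Γ s

    data Formula : Ctx → Set
    K : ∀ {Γ} → Formula Γ → Pred 𝔙 0ℓ

    -- The bound variable of a quantifier is the head of the context of its body.
    data Formula where
      metric : ∀ {Γ s} → Term Γ s → Term Γ s → Formula Γ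
      atom   : ∀ {Γ As} → Predicate As → All (Term Γ) As → Formula Γ
      conn   : ∀ {Γ n} (u : Vector 𝔙 n → 𝔙) → Continuous u → (Fin n → Formula Γ) → Formula Γ
      sup[_] : ∀ {Γ s} (ψ : Formula (s ∷ Γ)) → K ψ ⊆ ℝ≥0 → Formula Γ
      inf[_] : ∀ {Γ s} (ψ : Formula (s ∷ Γ)) → K ψ ⊆ ℝ≥0 → Formula Γ

    K (metric _ _)   = [0,1]
    K (atom P _)     = valueSet P
    K (conn u _ φs)  = λ v → ∃ λ ws → (∀ i → K (φs i) (ws i)) × v ≈ᵥ u ws
    K (sup[ ψ ] _)   = K ψ
    K (inf[ ψ ] _)   = K ψ

  module _ {L : Language} where
    open Language L

    open Structure using (Env)

    module _ (M : Structure L) where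
      open Structure M using (Carrier; dist; func; pred)

      ⟦_⟧ₜ : ∀ {Γ s} → Term L Γ s → Env M Γ → Carrier s
      ⟦_⟧ₐ : ∀ {Γ As} → All (Term L Γ) As → Env M Γ → Env M As

      ⟦ var i ⟧ₜ    e = All.lookup e i
      ⟦ app f ts ⟧ₜ e = func f (⟦ ts ⟧ₐ e)

      ⟦ [] ⟧ₐ     e = []
      ⟦ t ∷ ts ⟧ₐ e = ⟦ t ⟧ₜ e ∷ ⟦ ts ⟧ₐ e

      interpret : ∀ {Γ} → Formula L Γ → Env M Γ → 𝔙
      interpret (metric t t′) e = ι (dist (⟦ t ⟧ₜ e) (⟦ t′ ⟧ₜ e))
      interpret (atom P ts)   e = pred P (⟦ ts ⟧ₐ e)
      interpret (conn u _ φs) e = u (λ i → interpret (φs i) e)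
      interpret (sup[ ψ ] _)  e = ι (sup (λ r → ∃ λ a → interpret ψ (a ∷ e) ≈ᵥ ι r))
      interpret (inf[ ψ ] _)  e = ι (inf (λ r → ∃ λ a → interpret ψ (a ∷ e) ≈ᵥ ι r))

    record ElementaryExtension (M : Structure L) : Set₁ where
      field
        extension  : Structure L
        embed      : ∀ {s} → Structure.Carrier M s → Structure.Carrier extension s
        elementary : ∀ {Γ} (χ : Formula L Γ) (e : Env M Γ) →
          interpret extension χ (All.map embed e) ≈ᵥ interpret M χ e

    -- A formula φ(x,y): its variables are divided into object variables x and
    -- parameter variables y.  The formula φ*(y,x) is the same formula with these
    -- two roles exchanged.
    record PartitionedFormula (x y : Ctx L) : Set where
      field
        {vars}    : Ctx L
        formula   : Formula L vars
        partition : Interleaving x y vars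
    open PartitionedFormula

    _* : ∀ {x y} → PartitionedFormula x y → PartitionedFormula y x
    φ * = record { formula = formula φ ; partition = swap (partition φ) }

    merge : ∀ {x y vars} {P : Sort → Set} →
            Interleaving x y vars → All P x → All P y → All P vars
    merge []        []       []       = []
    merge (consˡ π) (a ∷ as) bs       = a ∷ merge π as bs
    merge (consʳ π) as       (b ∷ bs) = b ∷ merge π as bs

    value : ∀ {x y} (M : Structure L) → PartitionedFormula x y → Env M x → Env M y → 𝔙
    value M φ a b = interpret M (formula φ) (merge (partition φ) a b)

    merge-swap : ∀ {x y vars} {P : Sort → Set} (π : Interleaving x y vars)
                 (as : All P x) (bs : All P y) → merge (swap π) bs as ≡ merge π as bs
    merge-swap []        []       []       = refl
    merge-swap (consˡ π) (a ∷ as) bs       = cong (a ∷_) (merge-swap π as bs)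
    merge-swap (consʳ π) as       (b ∷ bs) = cong (b ∷_) (merge-swap π as bs)

    value-* : ∀ {x y} (M : Structure L) (φ : PartitionedFormula x y) a b →
              value M (φ *) b a ≡ value M φ a b
    value-* M φ a b = cong (interpret M (formula φ)) (merge-swap (partition φ) a b)

    module _ {x y : Ctx L} where

      -- A complete φ(x)-type p over M, presented by the function b ↦ φ(p,b) that
      -- determines it and a realization in an elementary extension of M.
      record CompleteType (φ : PartitionedFormula x y) (M : Structure L) : Set₁ where
        field
          at : Env M y → 𝔙
          N  : ElementaryExtension M
        open ElementaryExtension N
        field
          realization : Env extension x
          realizes    : ∀ b → at b ≈ᵥ value extension φ realization (All.map embed b)

      -- The φ(x)-formula u(φ(x,b₀),…,φ(x,bₙ₋₁)) over M.
      record FormulaOver (φ : PartitionedFormula x y) (M : Structure L) : Set where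
        field
          {arity}    : ℕ
          connective : Vector 𝔙 arity → 𝔙
          continuous : Continuous connective
          parameters : Fin arity → Env M y

        evaluate : Env M x → 𝔙
        evaluate a = connective (λ i → value M φ a (parameters i))

        evaluateType : CompleteType φ M → 𝔙
        evaluateType p = connective (λ i → CompleteType.at p (parameters i))

      open FormulaOver public using (evaluate; evaluateType)
      open CompleteType public using (at)

      Stable : R → PartitionedFormula x y → Structure L → Set
      Stable ε φ M = ¬ (Σ (ℕ → Env M x) λ a → Σ (ℕ → Env M y) λ b →
        ∀ i j → i ℕ.< j → ε ≤ 𝔡 (value M φ (a i) (b j)) (value M φ (a j) (b i)))

{-# OPTIONS --safe #-}
module Submission where

-- A type p over M is finitely approximated in M: for finitely many parameters bᵢ the
-- formula inf_x maxᵢ 𝔡(φ(p,bᵢ), φ(x,yᵢ)) is 0 at the bᵢ in the extension realizing p, hence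
-- in M.  So one can choose aₙ and bₙ in turn such that, up to η, aₙ looks like p to
-- b₀, …, bₙ₋₁ and to ψq, and bₙ looks like q to a₀, …, aₙ₋₁ and to ψp.  For i < j the value
-- φ(aⱼ,bᵢ) is then within δp + 2η of ψp(q), and φ(aᵢ,bⱼ) within δq + 2η of ψq(p).  If ψp(q)
-- and ψq(p) were at distance more than δp + δq + ε, a small η would make these sequences
-- contradict ε-stability.

open import Algebra.Bundles using (CommutativeRing)
import Algebra.Construct.NaturalChoice.Max as Max
import Algebra.Properties.Group as GroupProperties
import Algebra.Properties.Ring as RingProperties
import Algebra.Solver.CommutativeMonoid as CommutativeMonoidSolver
open import Axiom.ExcludedMiddle using (ExcludedMiddle)
open import Data.Fin.Base using (Fin; zero; suc)
open import Data.List.Base using (List; []; _∷_; _++_; lookup; tabulate)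
open import Data.List.Membership.Propositional using (_∈_)
open import Data.List.Membership.Propositional.Properties
  using (∈-++⁺ˡ; ∈-++⁺ʳ; ∈-tabulate⁺)
open import Data.List.Relation.Ternary.Interleaving.Propositional
  using (Interleaving; []; consˡ; consʳ)
open import Data.List.Relation.Unary.All as All using (All; []; _∷_)
open import Data.List.Relation.Unary.All.Properties
  using (++⁺; map-cong; map-∘; lookup-map)
open import Data.List.Relation.Unary.Any as Any using (here; there)
open import Data.List.Relation.Unary.Any.Properties using (lookup-index)
open import Data.Nat.Base as ℕ using (ℕ; zero; suc)
import Data.Nat.Properties as ℕ
open import Data.Product.Base using (∃; ∃₂; _×_; _,_; proj₁; proj₂)
open import Data.Sum.Base using (inj₁; inj₂)
open import Data.Vec.Functional using (Vector)
open import Function.Base using (_∘_)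
open import Level using (0ℓ)
open import Relation.Binary.Bundles using (TotalOrder)
import Relation.Binary.Construct.NonStrictToStrict as ToStrict
open import Relation.Binary.PropositionalEquality as ≡
  using (_≡_; refl; cong; cong₂; subst)
import Relation.Binary.Reasoning.PartialOrder as PartialOrderReasoning
open import Relation.Nullary.Decidable.Core using (yes; no)
open import Relation.Nullary.Negation.Core using (¬_; contradiction)
open import Relation.Unary using (Pred; _⊆_)
open import Defs

-- Arithmetic and order in a complete ordered field.

module OrderedField (ℝ : CompleteOrderedField) where
  open CompleteOrderedField ℝ
  open CommutativeRing commutativeRing public
    using ( ring; +-group; +-commutativeMonoid; +-cong; +-congˡ; +-congʳ; +-comm; +-assoc
          ; +-identityˡ; +-identityʳ; -‿inverseˡ; -‿inverseʳ; -‿cong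
          ; *-identityˡ; *-congʳ; distribʳ )
  open RingProperties ring public
    using (-‿involutive; -0#≈0#; -‿distribˡ-*)
  open GroupProperties +-group
    using (∙-cancelʳ; ⁻¹-anti-homo-//; x∙y⁻¹≈ε⇒x≈y; x≈y⇒x∙y⁻¹≈ε)
    renaming (//-rightDividesˡ to x-y+y≈x; //-rightDividesʳ to x+y-y≈x) public
  open TotalOrder totalOrder public
    using (poset; total; antisym; reflexive; module Eq) renaming (refl to ≤-refl; trans to ≤-trans)
  open Max totalOrder public
    using (⊔-lub; x≤x⊔y; x≤y⊔x; ⊔-comm; ⊔-cong; ⊔-sel)
  open PartialOrderReasoning poset

  ≰⇒> : ∀ {x y} → ¬ (x ≤ y) → y < x
  ≰⇒> = ToStrict.≰⇒> _≈_ _≤_ Eq.sym reflexive total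

  ≤-<-trans : ∀ {x y z} → x ≤ y → y < z → x < z
  ≤-<-trans x≤y y<z = begin-strict _ ≤⟨ x≤y ⟩ _ <⟨ y<z ⟩ _ ∎

  <-≤-trans : ∀ {x y z} → x < y → y ≤ z → x < z
  <-≤-trans x<y y≤z = begin-strict _ <⟨ x<y ⟩ _ ≤⟨ y≤z ⟩ _ ∎

  <⇒≱ : ∀ {x y} → x < y → ¬ (y ≤ x)
  <⇒≱ = ToStrict.<⇒≱ _≈_ _≤_ antisym

  +-mono-≤ : ∀ {a b c d} → a ≤ b → c ≤ d → a + c ≤ b + d
  +-mono-≤ {a} {b} {c} {d} a≤b c≤d = begin
    a + c ≤⟨ +-monoˡ-≤ c a≤b ⟩
    b + c ≈⟨ +-comm b c ⟩
    c + b ≤⟨ +-monoˡ-≤ b c≤d ⟩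
    d + b ≈⟨ +-comm d b ⟩
    b + d ∎

  +-monoˡ-< : ∀ z {x y} → x < y → x + z < y + z
  +-monoˡ-< z (x≤y , x≉y) = +-monoˡ-≤ z x≤y , x≉y ∘ ∙-cancelʳ z _ _

  +-cancelʳ-≤ : ∀ z {x y} → x + z ≤ y + z → x ≤ y
  +-cancelʳ-≤ z {x} {y} x+z≤y+z = begin
    x             ≈⟨ x+y-y≈x z x ⟨
    x + z + (- z) ≤⟨ +-monoˡ-≤ (- z) x+z≤y+z ⟩
    y + z + (- z) ≈⟨ x+y-y≈x z y ⟩
    y             ∎

  +-mono-≤-< : ∀ {a b c d} → a ≤ b → c < d → a + c < b + d
  +-mono-≤-< {a} {b} {c} {d} a≤b c<d = begin-strict
    a + c ≤⟨ +-monoˡ-≤ c a≤b ⟩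
    b + c ≈⟨ +-comm b c ⟩
    c + b <⟨ +-monoˡ-< b c<d ⟩
    d + b ≈⟨ +-comm d b ⟩
    b + d ∎

  +-cancelˡ-≤ : ∀ z {x y} → z + x ≤ z + y → x ≤ y
  +-cancelˡ-≤ z {x} {y} z+x≤z+y = +-cancelʳ-≤ z (begin
    x + z ≈⟨ +-comm x z ⟩
    z + x ≤⟨ z+x≤z+y ⟩
    z + y ≈⟨ +-comm z y ⟩
    y + z ∎)

  -‿antimono-≤ : ∀ {x y} → x ≤ y → - y ≤ - x
  -‿antimono-≤ {x} {y} x≤y = +-cancelʳ-≤ x (begin
    - y + x ≈⟨ +-comm (- y) x ⟩
    x - y   ≤⟨ +-monoˡ-≤ (- y) x≤y ⟩
    y - y   ≈⟨ -‿inverseʳ y ⟩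
    0#      ≈⟨ -‿inverseˡ x ⟨
    - x + x ∎)

  0≤⇒-≤0 : ∀ {x} → 0# ≤ x → - x ≤ 0#
  0≤⇒-≤0 0≤x = ≤-trans (-‿antimono-≤ 0≤x) (reflexive -0#≈0#)

  ≤0⇒0≤- : ∀ {x} → x ≤ 0# → 0# ≤ - x
  ≤0⇒0≤- x≤0 = ≤-trans (reflexive (Eq.sym -0#≈0#)) (-‿antimono-≤ x≤0)

  common-lower-bound : ∀ {P : Pred Carrier 0ℓ} {x y} → P x → P y → ∃ λ z → P z × z ≤ x × z ≤ y
  common-lower-bound {x = x} {y} Px Py with total x y
  ... | inj₁ x≤y = x , Px , ≤-refl , x≤y
  ... | inj₂ y≤x = y , Py , y≤x , ≤-refl

  ⊔-lub-< : ∀ {x y t} → x < t → y < t → x ⊔ y < t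
  ⊔-lub-< {x} {y} {t} x<t y<t with ⊔-sel x y
  ... | inj₁ x⊔y≈x = begin-strict
    x ⊔ y ≈⟨ x⊔y≈x ⟩
    x     <⟨ x<t ⟩
    t     ∎
  ... | inj₂ x⊔y≈y = begin-strict
    x ⊔ y ≈⟨ x⊔y≈y ⟩
    y     <⟨ y<t ⟩
    t     ∎

  ∣∣-cong : ∀ {x y} → x ≈ y → ∣ x ∣ ≈ ∣ y ∣
  ∣∣-cong x≈y = ⊔-cong x≈y (-‿cong x≈y)

  0≤∣x∣ : ∀ x → 0# ≤ ∣ x ∣
  0≤∣x∣ x with total 0# x
  ... | inj₁ 0≤x = ≤-trans 0≤x (x≤x⊔y x (- x))
  ... | inj₂ x≤0 = ≤-trans (≤0⇒0≤- x≤0) (x≤y⊔x x (- x))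

  ∣x-y∣≈∣y-x∣ : ∀ x y → ∣ x - y ∣ ≈ ∣ y - x ∣
  ∣x-y∣≈∣y-x∣ x y = Eq.trans (⊔-comm _ _)
    (⊔-cong (⁻¹-anti-homo-// x y) (Eq.sym (⁻¹-anti-homo-// y x)))

  ∣x-z∣≤∣x-y∣+∣y-z∣ : ∀ x y z → ∣ x - z ∣ ≤ ∣ x - y ∣ + ∣ y - z ∣
  ∣x-z∣≤∣x-y∣+∣y-z∣ x y z = begin
    ∣ x - z ∣               ≈⟨ ∣∣-cong x-z≈ ⟩
    ∣ (x - y) - (z - y) ∣   ≤⟨ ∣x-y∣≤∣x∣+∣y∣ (x - y) (z - y) ⟩
    ∣ x - y ∣ + ∣ z - y ∣   ≈⟨ +-congˡ (∣x-y∣≈∣y-x∣ z y) ⟩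
    ∣ x - y ∣ + ∣ y - z ∣   ∎
    where
    x-z≈ : x - z ≈ (x - y) - (z - y)
    x-z≈ = begin-equality
      x - z               ≈⟨ +-congʳ (x-y+y≈x y x) ⟨
      x - y + y - z       ≈⟨ +-assoc (x - y) y (- z) ⟩
      (x - y) + (y - z)   ≈⟨ +-congˡ (⁻¹-anti-homo-// z y) ⟨
      (x - y) - (z - y)   ∎

  ∣x∣≤0⇒x≈0 : ∀ {x} → ∣ x ∣ ≤ 0# → x ≈ 0#
  ∣x∣≤0⇒x≈0 {x} ∣x∣≤0 = antisym (≤-trans (x≤x⊔y x (- x)) ∣x∣≤0)
    (≤-trans (≤0⇒0≤- (≤-trans (x≤y⊔x x (- x)) ∣x∣≤0)) (reflexive (-‿involutive x)))

  x≈y⇒∣x-y∣≈0 : ∀ {x y} → x ≈ y → ∣ x - y ∣ ≈ 0#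
  x≈y⇒∣x-y∣≈0 x≈y = Eq.trans (∣∣-cong (x≈y⇒x∙y⁻¹≈ε x≈y))
    (antisym (⊔-lub ≤-refl (reflexive -0#≈0#)) (x≤x⊔y _ _))

  x<y+t⇒x-y<t : ∀ {x y t} → x < y + t → x - y < t
  x<y+t⇒x-y<t {x} {y} {t} x<y+t = begin-strict
    x - y     <⟨ +-monoˡ-< (- y) x<y+t ⟩
    y + t - y ≈⟨ +-congʳ (+-comm y t) ⟩
    t + y - y ≈⟨ x+y-y≈x y t ⟩
    t         ∎

  ∣x-y∣<t : ∀ {x y t} → x < y + t → y < x + t → ∣ x - y ∣ < t
  ∣x-y∣<t {x} {y} {t} x<y+t y<x+t = ⊔-lub-< (x<y+t⇒x-y<t x<y+t) (begin-strict
    - (x - y) ≈⟨ ⁻¹-anti-homo-// x y ⟩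
    y - x     <⟨ x<y+t⇒x-y<t y<x+t ⟩
    t         ∎)

  0≤1 : 0# ≤ 1#
  0≤1 with total 0# 1#
  ... | inj₁ 0≤1 = 0≤1
  ... | inj₂ 1≤0 = begin
    0#          ≤⟨ *-nonNegative (≤0⇒0≤- 1≤0) (≤0⇒0≤- 1≤0) ⟩
    - 1# * - 1# ≈⟨ -‿distribˡ-* 1# (- 1#) ⟨
    - (1# * - 1#) ≈⟨ -‿cong (*-identityˡ (- 1#)) ⟩
    - - 1#      ≈⟨ -‿involutive 1# ⟩
    1#          ∎

  -- The order makes `1# + 1#` nonzero, so `*-inverse` supplies one half, which is nonnegative
  -- because twice it is `1#`.
  half : ∀ {x} → 0# < x → ∃ λ y → 0# < y × y + y ≤ x
  half {x} (0≤x , 0≉x) = h * x , (*-nonNegative 0≤h 0≤x , 0≉hx) , reflexive hx+hx≈x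
    where
    2≉0 : ¬ (1# + 1# ≈ 0#)
    2≉0 2≈0 = 0≉1 (antisym 0≤1 (begin
      1#      ≈⟨ +-identityˡ 1# ⟨
      0# + 1# ≤⟨ +-monoˡ-≤ 1# 0≤1 ⟩
      1# + 1# ≈⟨ 2≈0 ⟩
      0#      ∎))
    h = proj₁ (*-inverse 2≉0)
    h+h≈1 : h + h ≈ 1#
    h+h≈1 = begin-equality
      h + h             ≈⟨ +-cong (*-identityˡ h) (*-identityˡ h) ⟨
      1# * h + 1# * h   ≈⟨ distribʳ h 1# 1# ⟨
      (1# + 1#) * h     ≈⟨ proj₂ (*-inverse 2≉0) ⟩
      1#                ∎
    0≤h : 0# ≤ h
    0≤h with total 0# h
    ... | inj₁ 0≤h = 0≤h
    ... | inj₂ h≤0 = contradiction (antisym 0≤1 (begin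
      1#      ≈⟨ h+h≈1 ⟨
      h + h   ≤⟨ +-mono-≤ h≤0 h≤0 ⟩
      0# + 0# ≈⟨ +-identityˡ 0# ⟩
      0#      ∎)) 0≉1
    hx+hx≈x : h * x + h * x ≈ x
    hx+hx≈x = begin-equality
      h * x + h * x ≈⟨ distribʳ x h h ⟨
      (h + h) * x   ≈⟨ *-congʳ h+h≈1 ⟩
      1# * x        ≈⟨ *-identityˡ x ⟩
      x             ∎
    0≉hx : ¬ (0# ≈ h * x)
    0≉hx 0≈hx = 0≉x (begin-equality
      0#            ≈⟨ +-identityˡ 0# ⟨
      0# + 0#       ≈⟨ +-cong 0≈hx 0≈hx ⟩
      h * x + h * x ≈⟨ hx+hx≈x ⟩
      x             ∎)

  -- Halving `y - x` twice. The path in `evaluations-close` spends four copies of `η`, one for each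
  -- approximation made.
  quarter-gap : ∀ {x y} → x < y → ∃ λ η → 0# < η × (η + η) + (η + η) + x ≤ y
  quarter-gap {x} {y} x<y =
    let θ , 0<θ , 2θ≤y-x = half 0<y-x
        η , 0<η , 2η≤θ   = half 0<θ
    in η , 0<η , (begin
      (η + η) + (η + η) + x ≤⟨ +-monoˡ-≤ x (≤-trans (+-mono-≤ 2η≤θ 2η≤θ) 2θ≤y-x) ⟩
      y - x + x             ≈⟨ x-y+y≈x x y ⟩
      y                     ∎)
    where
    0<y-x : 0# < y - x
    0<y-x = begin-strict
      0#    ≈⟨ -‿inverseʳ x ⟨
      x - x <⟨ +-monoˡ-< (- x) x<y ⟩
      y - x ∎

-- The sup metric on bounded sequences.

module LinftyMetric (em : ExcludedMiddle 0ℓ) (ℝ : CompleteOrderedField) where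
  open CompleteOrderedField ℝ using (_≈_; _≤_; _<_; _+_; 0#; ∣_∣)
  open Linfty ℝ
  open OrderedField ℝ
  open PartialOrderReasoning poset

  ∣seq∣≤‖‖ : ∀ v n → ∣ seq v n ∣ ≤ ‖ v ‖
  ∣seq∣≤‖‖ v n = proj₁ (proj₂ (CompleteOrderedField.supremum ℝ _ _ _)) _ (n , Eq.refl)

  ‖‖-least : ∀ v t → (∀ n → ∣ seq v n ∣ ≤ t) → ‖ v ‖ ≤ t
  ‖‖-least v t ∣v∣≤t = proj₂ (proj₂ (CompleteOrderedField.supremum ℝ _ _ _)) t
    λ { r (n , r≈) → ≤-trans (reflexive r≈) (∣v∣≤t n) }

  ≈ᵥ-reflexive : ∀ {v w} → v ≡ w → v ≈ᵥ w
  ≈ᵥ-reflexive refl n = Eq.refl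

  0≤𝔡 : ∀ v w → 0# ≤ 𝔡 v w
  0≤𝔡 v w = ≤-trans (0≤∣x∣ _) (∣seq∣≤‖‖ (v - w) 0)

  𝔡-sym : ∀ v w → 𝔡 v w ≤ 𝔡 w v
  𝔡-sym v w = ‖‖-least (v - w) _ λ n →
    ≤-trans (reflexive (∣x-y∣≈∣y-x∣ (seq v n) (seq w n))) (∣seq∣≤‖‖ (w - v) n)

  𝔡-triangle : ∀ u v w → 𝔡 u w ≤ 𝔡 u v + 𝔡 v w
  𝔡-triangle u v w = ‖‖-least (u - w) _ λ n →
    ≤-trans (∣x-z∣≤∣x-y∣+∣y-z∣ (seq u n) (seq v n) (seq w n))
            (+-mono-≤ (∣seq∣≤‖‖ (u - v) n) (∣seq∣≤‖‖ (v - w) n))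

  ≈ᵥ⇒𝔡≤0 : ∀ {v w} → v ≈ᵥ w → 𝔡 v w ≤ 0#
  ≈ᵥ⇒𝔡≤0 {v} {w} v≈w = ‖‖-least (v - w) _ λ n → reflexive (x≈y⇒∣x-y∣≈0 (v≈w n))

  𝔡≤0⇒≈ᵥ : ∀ {v w} → 𝔡 v w ≤ 0# → v ≈ᵥ w
  𝔡≤0⇒≈ᵥ {v} {w} 𝔡≤0 n = x∙y⁻¹≈ε⇒x≈y _ _ (∣x∣≤0⇒x≈0 (≤-trans (∣seq∣≤‖‖ (v - w) n) 𝔡≤0))

  𝔡-respʳ-< : ∀ {u v w t} → v ≈ᵥ w → 𝔡 u v < t → 𝔡 u w < t
  𝔡-respʳ-< {u} {v} {w} {t} v≈w 𝔡<t = begin-strict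
    𝔡 u w         ≤⟨ 𝔡-triangle u v w ⟩
    𝔡 u v + 𝔡 v w ≤⟨ +-mono-≤ ≤-refl (≈ᵥ⇒𝔡≤0 v≈w) ⟩
    𝔡 u v + 0#    ≈⟨ +-identityʳ _ ⟩
    𝔡 u v         <⟨ 𝔡<t ⟩
    t             ∎

  -- A connective is an arbitrary function on representatives; continuity makes it respect `≈ᵥ`. If
  -- the outputs were a positive distance apart, continuity with that distance as tolerance would
  -- make it smaller than itself, since inputs at distance 0 lie within every `η`.
  continuous-≈ᵥ : ∀ {n} {u : Vector 𝔙 n → 𝔙} → Continuous u →
                  ∀ {vs ws} → (∀ i → vs i ≈ᵥ ws i) → u vs ≈ᵥ u ws
  continuous-≈ᵥ {u = u} u-cont {vs} {ws} vs≈ws = 𝔡≤0⇒≈ᵥ 𝔡≤0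
    where
    𝔡≤0 : 𝔡 (u vs) (u ws) ≤ 0#
    𝔡≤0 with em {𝔡 (u vs) (u ws) ≤ 0#}
    ... | yes 𝔡≤0 = 𝔡≤0
    ... | no  𝔡≰0 =
      let η , 0<η , close = u-cont vs _ (≰⇒> 𝔡≰0)
      in contradiction (≤-refl {𝔡 (u vs) (u ws)}) (<⇒≱ (close ws λ i → ≤-<-trans (≈ᵥ⇒𝔡≤0 (vs≈ws i)) 0<η))

-- The maximum of finitely many distances as a continuous connective.

module FarthestDistance (em : ExcludedMiddle 0ℓ) (ℝ : CompleteOrderedField) (copy : IsometricCopy ℝ) where
  open CompleteOrderedField ℝ using (_≈_; _≤_; _<_; _+_; 0#; _⊔_; ∣_∣)
    renaming (Carrier to R; _-_ to _-ᵣ_)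
  open Linfty ℝ
  open IsometricCopy copy
  open OrderedField ℝ
  open LinftyMetric em ℝ
  open PartialOrderReasoning poset

  ι-cong : ∀ {r s} → r ≈ s → ι r ≈ᵥ ι s
  ι-cong {r} {s} r≈s = 𝔡≤0⇒≈ᵥ (reflexive (Eq.trans (isometry r s) (x≈y⇒∣x-y∣≈0 r≈s)))

  ι-injective : ∀ {r s} → ι r ≈ᵥ ι s → r ≈ s
  ι-injective {r} {s} ιr≈ιs = x∙y⁻¹≈ε⇒x≈y r s
    (∣x∣≤0⇒x≈0 (≤-trans (reflexive (Eq.sym (isometry r s))) (≈ᵥ⇒𝔡≤0 ιr≈ιs)))

  -- The vector `c` holds fixed elements of `𝔙`, later the values of a type. Built into the
  -- connective, they need not be values of formulas. The base value `0#` does not disturb a maximum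
  -- of distances.
  farthest : ∀ {n} → Vector 𝔙 n → Vector 𝔙 n → R
  farthest {zero}  c v = 0#
  farthest {suc n} c v = 𝔡 (c zero) (v zero) ⊔ farthest (c ∘ suc) (v ∘ suc)

  0≤farthest : ∀ {n} (c v : Vector 𝔙 n) → 0# ≤ farthest c v
  0≤farthest {zero}  c v = ≤-refl
  0≤farthest {suc n} c v = ≤-trans (0≤𝔡 _ _) (x≤x⊔y _ _)

  𝔡≤farthest : ∀ {n} (c v : Vector 𝔙 n) i → 𝔡 (c i) (v i) ≤ farthest c v
  𝔡≤farthest c v zero    = x≤x⊔y _ _
  𝔡≤farthest c v (suc i) = ≤-trans (𝔡≤farthest (c ∘ suc) (v ∘ suc) i) (x≤y⊔x _ _)

  -- The hypothesis `0# < t` settles the empty vector.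
  farthest-lub-< : ∀ {n} (c v : Vector 𝔙 n) {t} → 0# < t →
                   (∀ i → 𝔡 (c i) (v i) < t) → farthest c v < t
  farthest-lub-< {zero}  c v 0<t 𝔡<t = 0<t
  farthest-lub-< {suc n} c v 0<t 𝔡<t =
    ⊔-lub-< (𝔡<t zero) (farthest-lub-< (c ∘ suc) (v ∘ suc) 0<t (𝔡<t ∘ suc))

  farthest-shift : ∀ {n} (c v w : Vector 𝔙 n) {ε} → 0# < ε →
                   (∀ i → 𝔡 (v i) (w i) < ε) → farthest c w < farthest c v + ε
  farthest-shift c v w {ε} 0<ε v~w = farthest-lub-< c w
    (begin-strict
      0#                ≈⟨ +-identityˡ 0# ⟨
      0# + 0#           <⟨ +-mono-≤-< (0≤farthest c v) 0<ε ⟩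
      farthest c v + ε  ∎)
    λ i → begin-strict
      𝔡 (c i) (w i)                 ≤⟨ 𝔡-triangle (c i) (v i) (w i) ⟩
      𝔡 (c i) (v i) + 𝔡 (v i) (w i) <⟨ +-mono-≤-< (𝔡≤farthest c v i) (v~w i) ⟩
      farthest c v + ε              ∎

  -- By the triangle inequality the maximum moves by less than `ε` when every entry does, so `ε` is
  -- its own modulus; `farthest-shift` is applied in both directions.
  farthest-continuous : ∀ {n} (c : Vector 𝔙 n) → Continuous (ι ∘ farthest c)
  farthest-continuous c v ε 0<ε = ε , 0<ε , λ w v~w → begin-strict
    𝔡 (ι (farthest c v)) (ι (farthest c w)) ≈⟨ isometry _ _ ⟩
    ∣ farthest c v -ᵣ farthest c w ∣         <⟨ ∣x-y∣<t
      (farthest-shift c w v 0<ε λ i → ≤-<-trans (𝔡-sym (w i) (v i)) (v~w i))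
      (farthest-shift c v w 0<ε v~w) ⟩
    ε                                       ∎

-- Renaming of variables in formulas and its semantics.

module FormulaRenaming (em : ExcludedMiddle 0ℓ) (ℝ : CompleteOrderedField) (copy : IsometricCopy ℝ) where
  open CompleteOrderedField ℝ using (_≈_; IsUpperBound; IsSupremum; supremum)
  open ContinuousLogic em ℝ copy
  open Linfty ℝ using (_≈ᵥ_)
  open OrderedField ℝ
  open LinftyMetric em ℝ
  open FarthestDistance em ℝ copy

  sup-isSupremum : ∀ P → ∃ P → ∃ (IsUpperBound P) → IsSupremum P (sup P)
  sup-isSupremum P inhabited bounded with em {∃ P × ∃ (IsUpperBound P)}
  ... | yes (i , b) = proj₂ (supremum P i b)
  ... | no  ¬i×b    = contradiction (inhabited , bounded) ¬i×b

  -- Mutually included predicates share elements and upper bounds, so they fall into the same case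
  -- of the totalised `sup`; there each supremum is an upper bound for the other predicate.
  sup-cong : ∀ {P Q : Pred R 0ℓ} → P ⊆ Q → Q ⊆ P → sup P ≈ sup Q
  sup-cong {P} {Q} P⊆Q Q⊆P with em {∃ P × ∃ (IsUpperBound P)} | em {∃ Q × ∃ (IsUpperBound Q)}
  ... | yes (iP , bP) | yes (iQ , bQ) =
    let ubP , lubP = proj₂ (supremum P iP bP)
        ubQ , lubQ = proj₂ (supremum Q iQ bQ)
    in antisym (lubP _ λ r Pr → ubQ r (P⊆Q Pr)) (lubQ _ λ r Qr → ubP r (Q⊆P Qr))
  ... | yes ((r , Pr) , u , ub) | no ¬Q = contradiction ((r , P⊆Q Pr) , u , λ s → ub s ∘ Q⊆P) ¬Q
  ... | no ¬P | yes ((r , Qr) , u , ub) = contradiction ((r , Q⊆P Qr) , u , λ s → ub s ∘ P⊆Q) ¬P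
  ... | no _  | no _ = Eq.refl

  module _ {A : Set} where

    -- As a tuple of variables, a renaming can be built by `merge` and `All.map`, just like a tuple
    -- of elements.
    Renaming : List A → List A → Set
    Renaming Γ Δ = All (_∈ Δ) Γ

    lift : ∀ {Γ Δ s} → Renaming Γ Δ → Renaming (s ∷ Γ) (s ∷ Δ)
    lift ρ = here refl ∷ All.map there ρ

    pull : ∀ {P : A → Set} {Γ Δ} → Renaming Γ Δ → All P Δ → All P Γ
    pull ρ e = All.map (All.lookup e) ρ

    pull-there : ∀ {P : A → Set} {Γ Δ s} (ρ : Renaming Γ Δ) (a : P s) (e : All P Δ) →
                 pull (All.map there ρ) (a ∷ e) ≡ pull ρ e
    pull-there ρ a e = map-∘ ρ

  module _ {L : Language} where

    renameₜ : ∀ {Γ Δ s} → Renaming Γ Δ → Term L Γ s → Term L Δ s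
    renameₐ : ∀ {Γ Δ As} → Renaming Γ Δ → All (Term L Γ) As → All (Term L Δ) As
    renameₜ ρ (var i)    = var (All.lookup ρ i)
    renameₜ ρ (app f ts) = app f (renameₐ ρ ts)
    renameₐ ρ []         = []
    renameₐ ρ (t ∷ ts)   = renameₜ ρ t ∷ renameₐ ρ ts

    -- Defined together with `rename-K`: renaming under a quantifier must again show that the body
    -- has nonnegative values. Value sets do not depend on the terms in a formula, so the inclusion
    -- is immediate by induction.
    rename   : ∀ {Γ Δ} → Renaming Γ Δ → Formula L Γ → Formula L Δ
    rename-K : ∀ {Γ Δ} (ρ : Renaming Γ Δ) χ → K L (rename ρ χ) ⊆ K L χ
    rename ρ (metric t t′)   = metric (renameₜ ρ t) (renameₜ ρ t′)
    rename ρ (atom P ts)     = atom P (renameₐ ρ ts)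
    rename ρ (conn u c χs)   = conn u c (λ i → rename ρ (χs i))
    rename ρ (sup[ ψ ] ψ≥0)  = sup[ rename (lift ρ) ψ ] (λ v∈K → ψ≥0 (rename-K (lift ρ) ψ v∈K))
    rename ρ (inf[ ψ ] ψ≥0)  = inf[ rename (lift ρ) ψ ] (λ v∈K → ψ≥0 (rename-K (lift ρ) ψ v∈K))
    rename-K ρ (metric _ _)  v∈K = v∈K
    rename-K ρ (atom _ _)    v∈K = v∈K
    rename-K ρ (conn u c χs) (ws , ws∈K , v≈) = ws , (λ i → rename-K ρ (χs i) (ws∈K i)) , v≈
    rename-K ρ (sup[ ψ ] _)  v∈K = rename-K (lift ρ) ψ v∈K
    rename-K ρ (inf[ ψ ] _)  v∈K = rename-K (lift ρ) ψ v∈K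

    module _ (M : Structure L) where
      open Structure M using (func; pred; dist)

      ⟦renameₜ⟧ : ∀ {Γ Δ s} (ρ : Renaming Γ Δ) (t : Term L Γ s) e →
                  ⟦_⟧ₜ M (renameₜ ρ t) e ≡ ⟦_⟧ₜ M t (pull ρ e)
      ⟦renameₐ⟧ : ∀ {Γ Δ As} (ρ : Renaming Γ Δ) (ts : All (Term L Γ) As) e →
                  ⟦_⟧ₐ M (renameₐ ρ ts) e ≡ ⟦_⟧ₐ M ts (pull ρ e)
      ⟦renameₜ⟧ ρ (var i)    e = ≡.sym (lookup-map ρ i)
      ⟦renameₜ⟧ ρ (app f ts) e = cong (func f) (⟦renameₐ⟧ ρ ts e)
      ⟦renameₐ⟧ ρ []         e = refl
      ⟦renameₐ⟧ ρ (t ∷ ts)   e = cong₂ _∷_ (⟦renameₜ⟧ ρ t e) (⟦renameₐ⟧ ρ ts e)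

      -- Connectives transmit the equation by continuity; for quantifiers, body and renamed body
      -- take the same real values, so `sup-cong` applies.
      interpret-rename : ∀ {Γ Δ} (ρ : Renaming Γ Δ) χ e →
                         interpret M (rename ρ χ) e ≈ᵥ interpret M χ (pull ρ e)
      interpret-lift   : ∀ {Γ Δ s} (ρ : Renaming Γ Δ) (ψ : Formula L (s ∷ Γ)) a e →
                         interpret M (rename (lift ρ) ψ) (a ∷ e) ≈ᵥ interpret M ψ (a ∷ pull ρ e)
      interpret-rename ρ (metric t t′) e =
        ι-cong (Eq.reflexive (cong₂ dist (⟦renameₜ⟧ ρ t e) (⟦renameₜ⟧ ρ t′ e)))
      interpret-rename ρ (atom P ts)   e = ≈ᵥ-reflexive (cong (pred P) (⟦renameₐ⟧ ρ ts e))
      interpret-rename ρ (conn u u-cont χs) e =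
        continuous-≈ᵥ u-cont (λ i → interpret-rename ρ (χs i) e)
      interpret-rename ρ (sup[ ψ ] _) e = ι-cong (sup-cong
        (λ (a , ≈ιr) → a , λ n → Eq.trans (Eq.sym (interpret-lift ρ ψ a e n)) (≈ιr n))
        (λ (a , ≈ιr) → a , λ n → Eq.trans (interpret-lift ρ ψ a e n) (≈ιr n)))
      interpret-rename ρ (inf[ ψ ] _) e = ι-cong (-‿cong (sup-cong
        (λ (a , ≈ιr) → a , λ n → Eq.trans (Eq.sym (interpret-lift ρ ψ a e n)) (≈ιr n))
        (λ (a , ≈ιr) → a , λ n → Eq.trans (interpret-lift ρ ψ a e n) (≈ιr n))))
      -- Pulling back along `lift ρ` computes to `a` at the head; only the tail, where every
      -- variable is shifted by `there`, has to be rewritten.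
      interpret-lift ρ ψ a e = subst (λ e′ → interpret M (rename (lift ρ) ψ) (a ∷ e) ≈ᵥ interpret M ψ (a ∷ e′))
        (pull-there ρ a e) (interpret-rename (lift ρ) ψ (a ∷ e))

-- Infima over tuples of variables.

module IteratedInfimum (em : ExcludedMiddle 0ℓ) (ℝ : CompleteOrderedField) (copy : IsometricCopy ℝ) where
  open CompleteOrderedField ℝ using (_≈_; -_)
  open ContinuousLogic em ℝ copy
  open Linfty ℝ using (_≈ᵥ_)
  open IsometricCopy copy using (ι)
  open OrderedField ℝ
  open LinftyMetric em ℝ
  open FarthestDistance em ℝ copy
  open FormulaRenaming em ℝ copy

  module _ {P : Pred R 0ℓ} (P-resp-≈ : ∀ {r s} → r ≈ s → P r → P s)
           (inhabited : ∃ P) (P≥0 : ∀ {r} → P r → 0# ≤ r) where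

    private
      -- The set of negatives is inhabited and bounded above by `0#`, so `sup` does not take its
      -- default value.
      isSupremum = sup-isSupremum (P ∘ -_)
        (- proj₁ inhabited , P-resp-≈ (Eq.sym (-‿involutive _)) (proj₂ inhabited))
        (0# , λ r P-r → ≤-trans (reflexive (Eq.sym (-‿involutive r))) (0≤⇒-≤0 (P≥0 P-r)))

    0≤inf : 0# ≤ inf P
    0≤inf = ≤0⇒0≤- (proj₂ isSupremum 0# λ r P-r →
      ≤-trans (reflexive (Eq.sym (-‿involutive r))) (0≤⇒-≤0 (P≥0 P-r)))

    inf≤ : ∀ {r} → P r → inf P ≤ r
    inf≤ {r} Pr = ≤-trans
      (-‿antimono-≤ (proj₁ isSupremum (- r) (P-resp-≈ (Eq.sym (-‿involutive r)) Pr)))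
      (reflexive (-‿involutive r))

    -- If no element were below `t`, then `t` would be a lower bound and hence at most the infimum.
    inf<⇒∃< : ∀ {t} → inf P < t → ∃ λ r → P r × r < t
    inf<⇒∃< {t} inf<t with em {∃ λ r → P r × r < t}
    ... | yes found = found
    ... | no  none  = contradiction t≤inf (<⇒≱ inf<t)
      where
      t≤ : ∀ r → P (- r) → t ≤ - r
      t≤ r P-r with em {t ≤ - r}
      ... | yes t≤-r = t≤-r
      ... | no  t≰-r = contradiction (- r , P-r , ≰⇒> t≰-r) none
      t≤inf : t ≤ inf P
      t≤inf = ≤-trans (reflexive (Eq.sym (-‿involutive t))) (-‿antimono-≤ (proj₂ isSupremum (- t) λ r P-r →
        ≤-trans (reflexive (Eq.sym (-‿involutive r))) (-‿antimono-≤ (t≤ r P-r))))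

  module _ {L : Language} where

    -- The head of the tuple is quantified innermost. An infimum has the same value set as its body,
    -- so one proof of nonnegativity serves at every stage.
    infs : ∀ x {Γ} (ψ : Formula L (x ++ Γ)) → K L ψ ⊆ ℝ≥0 → Formula L Γ
    infs []      ψ ψ≥0 = ψ
    infs (s ∷ x) ψ ψ≥0 = infs x (inf[ ψ ] ψ≥0) ψ≥0

    module _ (M : Structure L) where
      open Structure M using (Env; inhabited)

      -- Strict upper bounds pass through infima in both directions, although an infimum need not be
      -- attained.
      Below : ∀ {Γ} → Formula L Γ → Env Γ → R → Set
      Below ψ e t = ∃ λ r → r < t × interpret M ψ e ≈ᵥ ι r

      module _ {Γ s} (ψ : Formula L (s ∷ Γ)) (K≥0 : K L ψ ⊆ ℝ≥0)
               (ψ≥0 : ∀ e → ℝ≥0 (interpret M ψ e)) (e : Env Γ) where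

        private
          Value : Pred R 0ℓ
          Value r = ∃ λ a → interpret M ψ (a ∷ e) ≈ᵥ ι r

          Value-resp-≈ : ∀ {r s} → r ≈ s → Value r → Value s
          Value-resp-≈ r≈s (a , ≈ιr) = a , λ n → Eq.trans (≈ιr n) (ι-cong r≈s n)

          Value-inhabited : ∃ Value
          Value-inhabited =
            let r , _ , ≈ιr = ψ≥0 (inhabited s ∷ e) in r , inhabited s , ≈ιr

          Value≥0 : ∀ {r} → Value r → 0# ≤ r
          Value≥0 {r} (a , ≈ιr) =
            let r′ , 0≤r′ , ≈ιr′ = ψ≥0 (a ∷ e)
            in ≤-trans 0≤r′ (reflexive (ι-injective λ n → Eq.trans (Eq.sym (≈ιr′ n)) (≈ιr n)))

        -- This carries the induction over a tuple: `K≥0` is the syntactic condition for forming the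
        -- quantifier, while `ψ≥0` concerns the values in `M` and must be renewed after each
        -- infimum.
        inf≥0 : ℝ≥0 (interpret M (inf[ ψ ] K≥0) e)
        inf≥0 = _ , 0≤inf Value-resp-≈ Value-inhabited Value≥0 , λ _ → Eq.refl

        below-inf⁺ : ∀ a {t} → Below ψ (a ∷ e) t → Below (inf[ ψ ] K≥0) e t
        below-inf⁺ a (r , r<t , ≈ιr) =
          _ , ≤-<-trans (inf≤ Value-resp-≈ Value-inhabited Value≥0 (a , ≈ιr)) r<t , λ _ → Eq.refl

        below-inf⁻ : ∀ {t} → Below (inf[ ψ ] K≥0) e t → ∃ λ a → Below ψ (a ∷ e) t
        below-inf⁻ (r , r<t , ≈ιr) =
          let r′ , (a , ≈ιr′) , r′<t = inf<⇒∃< Value-resp-≈ Value-inhabited Value≥0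
                (≤-<-trans (reflexive (ι-injective ≈ιr)) r<t)
          in a , r′ , r′<t , ≈ιr′

      below-infs⁺ : ∀ x {Γ} (ψ : Formula L (x ++ Γ)) (K≥0 : K L ψ ⊆ ℝ≥0) →
                    (∀ e → ℝ≥0 (interpret M ψ e)) → ∀ (a : Env x) e {t} →
                    Below ψ (++⁺ a e) t → Below (infs x ψ K≥0) e t
      below-infs⁺ []      ψ K≥0 ψ≥0 []       e below = below
      below-infs⁺ (s ∷ x) ψ K≥0 ψ≥0 (a ∷ as) e below =
        below-infs⁺ x (inf[ ψ ] K≥0) K≥0 (inf≥0 ψ K≥0 ψ≥0) as e (below-inf⁺ ψ K≥0 ψ≥0 (++⁺ as e) a below)

      below-infs⁻ : ∀ x {Γ} (ψ : Formula L (x ++ Γ)) (K≥0 : K L ψ ⊆ ℝ≥0) →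
                    (∀ e → ℝ≥0 (interpret M ψ e)) → ∀ e {t} →
                    Below (infs x ψ K≥0) e t → ∃ λ (a : Env x) → Below ψ (++⁺ a e) t
      below-infs⁻ []      ψ K≥0 ψ≥0 e below = [] , below
      below-infs⁻ (s ∷ x) ψ K≥0 ψ≥0 e below =
        let as , below′ = below-infs⁻ x (inf[ ψ ] K≥0) K≥0 (inf≥0 ψ K≥0 ψ≥0) e below
            a , below″  = below-inf⁻ ψ K≥0 ψ≥0 (++⁺ as e) below′
        in a ∷ as , below″

-- Finite approximation of types inside the structure.

module Approximation (em : ExcludedMiddle 0ℓ) (ℝ : CompleteOrderedField) (copy : IsometricCopy ℝ) where
  open ContinuousLogic em ℝ copy
  open Linfty ℝ using (𝔙; _≈ᵥ_)
  open IsometricCopy copy using (ι)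
  open OrderedField ℝ
  open LinftyMetric em ℝ
  open FarthestDistance em ℝ copy
  open FormulaRenaming em ℝ copy
  open IteratedInfimum em ℝ copy

  module _ {A : Set} where

    inˡ : ∀ (x : List A) {Γ} → Renaming x (x ++ Γ)
    inˡ []      = []
    inˡ (s ∷ x) = lift (inˡ x)

    inʳ : ∀ (x : List A) {Γ Δ} → Renaming Γ Δ → Renaming Γ (x ++ Δ)
    inʳ x = All.map (∈-++⁺ʳ x)

    -- Each of the `n` parameter tuples gets its own copy of `y`, because a single formula has to
    -- mention all of them.
    blocks : List A → ℕ → List A
    blocks y zero    = []
    blocks y (suc n) = y ++ blocks y n

    block : ∀ (y : List A) {n} → Fin n → Renaming y (blocks y n)
    block y zero    = inˡ y
    block y (suc i) = inʳ y (block y i)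

    module _ {P : A → Set} where

      pull-inˡ : ∀ {x Γ} (a : All P x) (e : All P Γ) → pull (inˡ x) (++⁺ a e) ≡ a
      pull-inˡ {[]}    []       e = refl
      pull-inˡ {s ∷ x} (a ∷ as) e = cong (a ∷_)
        (≡.trans (pull-there (inˡ x) a (++⁺ as e)) (pull-inˡ as e))

      pull-inʳ : ∀ {x Γ Δ} (ρ : Renaming Γ Δ) (a : All P x) (e : All P Δ) →
                 pull (inʳ x ρ) (++⁺ a e) ≡ pull ρ e
      pull-inʳ ρ a e = ≡.trans (map-∘ ρ) (map-cong ρ (lookup-++⁺ʳ a e))
        where
        lookup-++⁺ʳ : ∀ {x Δ} (a : All P x) (e : All P Δ) {s} (i : s ∈ Δ) →
                      All.lookup (++⁺ a e) (∈-++⁺ʳ x i) ≡ All.lookup e i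
        lookup-++⁺ʳ []       e i = refl
        lookup-++⁺ʳ (_ ∷ as) e i = lookup-++⁺ʳ as e i

      pack : ∀ {y n} → (Fin n → All P y) → All P (blocks y n)
      pack {n = zero}  bs = []
      pack {n = suc n} bs = ++⁺ (bs zero) (pack (bs ∘ suc))

      pull-block : ∀ {y n} (bs : Fin n → All P y) i → pull (block y i) (pack bs) ≡ bs i
      pull-block bs zero    = pull-inˡ (bs zero) _
      pull-block bs (suc i) = ≡.trans (pull-inʳ (block _ i) (bs zero) _) (pull-block (bs ∘ suc) i)

    map-++⁺ : ∀ {P Q : A → Set} (f : ∀ {s} → P s → Q s) {x Γ} (a : All P x) (e : All P Γ) →
              All.map f (++⁺ a e) ≡ ++⁺ (All.map f a) (All.map f e)
    map-++⁺ f []       e = refl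
    map-++⁺ f (a ∷ as) e = cong (f a ∷_) (map-++⁺ f as e)

    map-pack : ∀ {P Q : A → Set} (f : ∀ {s} → P s → Q s) {y n} (bs : Fin n → All P y) →
               All.map f (pack bs) ≡ pack (λ i → All.map f (bs i))
    map-pack f {n = zero}  bs = refl
    map-pack f {n = suc n} bs = ≡.trans (map-++⁺ f (bs zero) _)
      (cong (++⁺ (All.map f (bs zero))) (map-pack f (bs ∘ suc)))

  module _ {L : Language} where
    open Language L using (Sort)

    map-merge : ∀ {x y vars} {P Q : Sort → Set} (f : ∀ {s} → P s → Q s) (π : Interleaving x y vars)
                (as : All P x) (bs : All P y) →
                All.map f (merge {L} π as bs) ≡ merge {L} π (All.map f as) (All.map f bs)
    map-merge f []        []       []       = refl
    map-merge f (consˡ π) (a ∷ as) bs       = cong (f a ∷_) (map-merge f π as bs)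
    map-merge f (consʳ π) as       (b ∷ bs) = cong (f b ∷_) (map-merge f π as bs)

    module _ {x y : Ctx L} (φ : PartitionedFormula {L} x y) where
      open PartitionedFormula φ

      module _ {n} (c : Vector 𝔙 n) where

        -- The formula maxᵢ 𝔡(cᵢ, φ(x, yᵢ)) in the variables x, y₀, …, yₙ₋₁.
        distance : Formula L (x ++ blocks y n)
        distance = conn (λ v → ι (farthest c v)) (farthest-continuous c)
          λ i → rename (merge {L} partition (inˡ x) (inʳ x (block y i))) formula

        -- The formula `φ` may take values anywhere in `𝔙`; the outer connective ends in `ι` of a
        -- nonnegative real, which permits quantification.
        distance-K≥0 : K L distance ⊆ ℝ≥0
        distance-K≥0 (ws , _ , v≈) = farthest c ws , 0≤farthest c ws , v≈

        module _ (M : Structure L) (a : Structure.Env M x) (bs : Fin n → Structure.Env M y) where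

          -- Pulling an environment back along a renaming is an `All.map`, so it commutes with
          -- `merge`; the two halves then read off `a` and `bs i`.
          interpret-instance : ∀ i →
            interpret M (rename (merge {L} partition (inˡ x) (inʳ x (block y i))) formula)
              (++⁺ a (pack bs)) ≈ᵥ value M φ a (bs i)
          interpret-instance i =
            subst (λ e → interpret M (rename ρ formula) (++⁺ a (pack bs)) ≈ᵥ interpret M formula e)
              (≡.trans (map-merge _ partition (inˡ x) (inʳ x (block y i)))
                (cong₂ (merge {L} partition) (pull-inˡ a (pack bs))
                  (≡.trans (pull-inʳ (block y i) a (pack bs)) (pull-block bs i))))
              (interpret-rename M ρ formula (++⁺ a (pack bs)))
            where
            ρ = merge {L} partition (inˡ x) (inʳ x (block y i))

          below-distance⁺ : ∀ {t} → 0# < t → (∀ i → 𝔡 (c i) (value M φ a (bs i)) < t) →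
                            Below M distance (++⁺ a (pack bs)) t
          below-distance⁺ 0<t close = _ ,
            farthest-lub-< c _ 0<t (λ i → 𝔡-respʳ-< (Eq.sym ∘ interpret-instance i) (close i)) ,
            λ _ → Eq.refl

          below-distance⁻ : ∀ {t} → Below M distance (++⁺ a (pack bs)) t →
                            ∀ i → 𝔡 (c i) (value M φ a (bs i)) < t
          below-distance⁻ (r , r<t , ≈ιr) i = 𝔡-respʳ-< (interpret-instance i)
            (≤-<-trans (≤-trans (𝔡≤farthest c _ i) (reflexive (ι-injective ≈ιr))) r<t)

        -- The formula inf_x maxᵢ 𝔡(cᵢ, φ(x, yᵢ)): how closely a single tuple in place of `x` can
        -- produce the values `c` at all the `yᵢ`.
        nearest : Formula L (blocks y n)
        nearest = infs x distance (λ {v} → distance-K≥0 {v})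

        module _ (M : Structure L) (bs : Fin n → Structure.Env M y) where

          interpret-distance≥0 : ∀ e → ℝ≥0 (interpret M distance e)
          interpret-distance≥0 e = _ , 0≤farthest c _ , λ _ → Eq.refl

          below-nearest⁺ : ∀ a {t} → 0# < t → (∀ i → 𝔡 (c i) (value M φ a (bs i)) < t) →
                           Below M nearest (pack bs) t
          below-nearest⁺ a 0<t close =
            below-infs⁺ M x distance (λ {v} → distance-K≥0 {v}) interpret-distance≥0 a (pack bs)
              (below-distance⁺ M a bs 0<t close)

          below-nearest⁻ : ∀ {t} → Below M nearest (pack bs) t →
                           ∃ λ a → ∀ i → 𝔡 (c i) (value M φ a (bs i)) < t
          below-nearest⁻ below =
            let a , below′ = below-infs⁻ M x distance (λ {v} → distance-K≥0 {v})
                               interpret-distance≥0 (pack bs) below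
            in a , below-distance⁻ M a bs below′

      module _ {M : Structure L} (p : CompleteType φ M) where
        open Structure M using (Env)
        open CompleteType p using (N; realization; realizes)
        open ElementaryExtension N

        -- The realization brings all distances to 0 in the extension, so `nearest` is below `t`
        -- there. Elementarity carries this bound to `M`, where it yields a tuple; exact agreement
        -- could fail, as the infimum need not be attained in `M`.
        approximate : ∀ {n} (bs : Fin n → Env y) {t} → 0# < t →
                      ∃ λ a → ∀ i → 𝔡 (at p (bs i)) (value M φ a (bs i)) < t
        approximate bs {t} 0<t =
          let r , r<t , ≈ιr = below-nearest⁺ c extension _ realization 0<t λ i →
                ≤-<-trans (≈ᵥ⇒𝔡≤0 (realizes (bs i))) 0<t
          in below-nearest⁻ c M bs (r , r<t , λ n → Eq.trans (Eq.sym (transfer n)) (≈ιr n))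
          where
          c = λ i → at p (bs i)
          transfer : interpret extension (nearest c) (pack (λ i → All.map embed (bs i))) ≈ᵥ
                     interpret M (nearest c) (pack bs)
          -- Packing commutes with `embed`, so `elementary` applies to the packed parameters.
          transfer = subst (λ e → interpret extension (nearest c) e ≈ᵥ interpret M (nearest c) (pack bs))
            (map-pack embed bs) (elementary (nearest c) (pack bs))

        approximate-list : (bs : List (Env y)) → ∀ {t} → 0# < t →
                           ∃ λ a → ∀ {b} → b ∈ bs → 𝔡 (at p b) (value M φ a b) < t
        approximate-list bs {t} 0<t =
          let a , close = approximate (lookup bs) 0<t
          in a , λ b∈bs → subst (λ b → 𝔡 (at p b) (value M φ a b) < t)
            (≡.sym (lookup-index b∈bs)) (close (Any.index b∈bs))

        -- Approximating `p` also at the parameters of `ψ` controls `ψ` itself, by continuity of its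
        -- connective at the values of `p`. The tolerance `θ` is the smaller of the one this
        -- requires and `t`.
        approximate-with : (ψ : FormulaOver φ M) (bs : List (Env y)) → ∀ {t} → 0# < t →
          ∃ λ a → 𝔡 (evaluateType ψ p) (evaluate ψ a) < t ×
                  (∀ {b} → b ∈ bs → 𝔡 (at p b) (value M φ a b) < t)
        approximate-with ψ bs {t} 0<t =
          let η , 0<η , close = continuous (λ i → at p (parameters i)) t 0<t
              θ , 0<θ , θ≤η , θ≤t = common-lower-bound {0# <_} 0<η 0<t
              a , near = approximate-list (tabulate parameters ++ bs) 0<θ
          in a , close _ (λ i → <-≤-trans (near (∈-++⁺ˡ (∈-tabulate⁺ i))) θ≤η)
               , λ b∈bs → <-≤-trans (near (∈-++⁺ʳ (tabulate parameters) b∈bs)) θ≤t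
          where open FormulaOver ψ

-- Two sequences chosen in turn.

module _ {A B : Set} {Q₀ : A → Set} {P₀ : B → Set} {P Q : A → B → Set}
  (chooseˡ : ∀ bs → ∃ λ a → Q₀ a × (∀ {b} → b ∈ bs → P a b))
  (chooseʳ : ∀ as → ∃ λ b → P₀ b × (∀ {a} → a ∈ as → Q a b)) where

  -- The histories `as n` and `bs n` list the choices with index below `n`. Both choices at stage
  -- `n` see only these, so nothing relates `a n` to `b n`, and the conclusion is for `i < j` only.
  alternating-sequences : ∃₂ λ (a : ℕ → A) (b : ℕ → B) →
    (∀ i → Q₀ (a i)) × (∀ i → P₀ (b i)) × (∀ {i j} → i ℕ.< j → P (a j) (b i) × Q (a i) (b j))
  alternating-sequences = a , b , (λ i → proj₁ (proj₂ (chooseˡ (bs i))))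
                                , (λ i → proj₁ (proj₂ (chooseʳ (as i))))
                                , λ {i} {j} i<j → proj₂ (proj₂ (chooseˡ (bs j))) (proj₂ (earlier i<j))
                                                , proj₂ (proj₂ (chooseʳ (as j))) (proj₁ (earlier i<j))
    where
    as : ℕ → List A
    bs : ℕ → List B
    a : ℕ → A
    b : ℕ → B
    as zero    = []
    as (suc n) = a n ∷ as n
    bs zero    = []
    bs (suc n) = b n ∷ bs n
    a n = proj₁ (chooseˡ (bs n))
    b n = proj₁ (chooseʳ (as n))
    earlier : ∀ {i j} → i ℕ.< j → a i ∈ as j × b i ∈ bs j
    earlier {i} {suc j} i<1+j with ℕ.m<1+n⇒m<n∨m≡n i<1+j
    ... | inj₁ i<j  = let ai∈ , bi∈ = earlier i<j in there ai∈ , there bi∈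
    ... | inj₂ refl = here refl , here refl

-- Comparison of the two evaluations and contradiction with stability.

module _ (em : ExcludedMiddle 0ℓ) (ℝ : CompleteOrderedField) (copy : IsometricCopy ℝ) where
  open ContinuousLogic em ℝ copy
  open OrderedField ℝ
  open LinftyMetric em ℝ
  open Approximation em ℝ copy
  open CommutativeMonoidSolver +-commutativeMonoid using (solve; _⊜_; _⊕_)
  open PartialOrderReasoning poset

  module _ {L : Language} {M : Structure L} {x y : Ctx L} (φ : PartitionedFormula {L} x y)
    (p : CompleteType φ M) (q : CompleteType (φ *) M)
    (ψp : FormulaOver (φ *) M) (ψq : FormulaOver φ M) {δp δq : R}
    (p-defined : ∀ b → 𝔡 (at p b) (evaluate ψp b) ≤ δp)
    (q-defined : ∀ a → 𝔡 (at q a) (evaluate ψq a) ≤ δq) where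

    open Structure M using (Env)

    -- The path ψp(q), ψp(b), φ(p,b), φ(a′,b), φ(a,b′), φ*(q,a), ψq(a), ψq(p).
    evaluations-close : ∀ {η} {a a′ : Env x} {b b′ : Env y} →
      𝔡 (evaluateType ψp q) (evaluate ψp b) < η →
      𝔡 (at p b) (value M φ a′ b) < η →
      𝔡 (at q a) (value M (φ *) b′ a) < η →
      𝔡 (evaluateType ψq p) (evaluate ψq a) < η →
      𝔡 (evaluateType ψp q) (evaluateType ψq p) ≤
      (η + η) + (η + η) + (δp + δq + 𝔡 (value M φ a b′) (value M φ a′ b))
    evaluations-close {η} {a} {a′} {b} {b′} ψp-near p-near q-near ψq-near = begin
      -- The seven segments cost `η`, `δp`, `η`, `X`, `η`, `δq`, `η` in this order; `proj₁` weakens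
      -- a strict bound to `≤`.
      𝔡 A B ≤⟨ via (evaluate ψp b) (proj₁ ψp-near)
              (via (at p b) (≤-trans (𝔡-sym _ _) (p-defined b))
              (via (value M φ a′ b) (proj₁ p-near)
              (via (value M φ a b′) (𝔡-sym _ _)
              (via (at q a) (≤-trans (𝔡-sym _ _) (proj₁ q-near′))
              (via (evaluate ψq a) (q-defined a)
              (≤-trans (𝔡-sym _ _) (proj₁ ψq-near))))))) ⟩
      η + (δp + (η + (X + (η + (δq + η)))))
        ≈⟨ solve 4 (λ η δp δq X → η ⊕ (δp ⊕ (η ⊕ (X ⊕ (η ⊕ (δq ⊕ η)))))
                                ⊜ ((η ⊕ η) ⊕ (η ⊕ η)) ⊕ ((δp ⊕ δq) ⊕ X))
             Eq.refl η δp δq X ⟩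
      (η + η) + (η + η) + (δp + δq + X) ∎
      where
      A = evaluateType ψp q
      B = evaluateType ψq p
      X = 𝔡 (value M φ a b′) (value M φ a′ b)
      q-near′ : 𝔡 (at q a) (value M φ a b′) < η
      q-near′ = subst (λ v → 𝔡 (at q a) v < η) (value-* M φ a b′) q-near
      via : ∀ {u w} v {r s} → 𝔡 u v ≤ r → 𝔡 v w ≤ s → 𝔡 u w ≤ r + s
      via v 𝔡≤r 𝔡≤s = ≤-trans (𝔡-triangle _ v _) (+-mono-≤ 𝔡≤r 𝔡≤s)

    unstable : ∀ {ε} → δp + δq + ε < 𝔡 (evaluateType ψp q) (evaluateType ψq p) → ¬ Stable ε φ M
    unstable {ε} S<D stable =
      let η , 0<η , 4η+S≤D = quarter-gap S<D
          a , b , ψq-near , ψp-near , near = alternating-sequences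
            (λ bs → approximate-with φ p ψq bs 0<η)
            (λ as → approximate-with (φ *) q ψp as 0<η)
      -- The path is taken with `a i`, `b i` and with `a j`, `b j` as the primed tuples, so its
      -- middle segment is the distance in the definition of stability. Cancelling the four `η` and
      -- `δp + δq` leaves `ε` at most that distance.
      in stable (a , b , λ i j i<j →
        +-cancelˡ-≤ (δp + δq) (+-cancelˡ-≤ ((η + η) + (η + η)) (≤-trans 4η+S≤D
          (evaluations-close (ψp-near i) (proj₁ (near i<j)) (proj₂ (near i<j)) (ψq-near i)))))

proposition3p10 : (em : ExcludedMiddle 0ℓ) (ℝ : CompleteOrderedField) (copy : IsometricCopy ℝ) →
    let open ContinuousLogic em ℝ copy in
    (L : Language) (M : Structure L) (x y : Ctx L) (φ : PartitionedFormula x y)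
    (ε : R) → 0# < ε → Stable ε φ M →
    (p : CompleteType φ M) (q : CompleteType (φ *) M)
    (ψp : FormulaOver (φ *) M) (ψq : FormulaOver φ M)
    (δp δq : R) → 0# < δp → 0# < δq →
    (∀ b → 𝔡 (at p b) (evaluate ψp b) ≤ δp) →
    (∀ a → 𝔡 (at q a) (evaluate ψq a) ≤ δq) →
    𝔡 (evaluateType ψp q) (evaluateType ψq p) ≤ δp + δq + ε
proposition3p10 em ℝ copy L M x y φ ε 0<ε stable p q ψp ψq δp δq 0<δp 0<δq p-defined q-defined
  with em {CompleteOrderedField._≤_ ℝ _ _}
... | yes D≤S = D≤S
... | no  D≰S = contradiction stable
  (unstable em ℝ copy φ p q ψp ψq p-defined q-defined (OrderedField.≰⇒> ℝ D≰S))
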